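{- Let $H$ be a $k$-uniform $k$-partite hypergraph with $d_1(H)=d$. There exist a constant $c_k>0$ depending only on $k$ and a constant $C_H$ depending on $H$ such that every $n$-vertex $k$-uniform hypergraph with at least $C_H n^{k-c_k/d^{k-1}}$ edges contains a copy of $H$.
   Context: A hypergraph is $k$-partite if its vertex set can be partitioned into $k$ parts so that each edge has exactly one vertex in each part. The $1$-skeleton $H^{(1)}$ of a $k$-uniform hypergraph $H$ is the graph on $V(H)$ in which two vertices are adjacent iff they lie in a common edge of $H$; the skeletal degeneracy $d_1(H)$ is the degeneracy of $H^{(1)}$, i.e. the least $d$ such that every subgraph of $H^{(1)}$ has minimum degree at most $d$. -}

module Defs where

open import Data.Nat using (ℕ; zero; suc; _+_; _*_; _^_; _≤_)
open import Data.Bool using (Bool; true; false; T; _∧_; not)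
open import Data.Fin using (Fin; zero; suc)
open import Data.Fin.Properties using (_≟_)
open import Data.Fin.Subset using (Subset; _∈_; ∣_∣; Nonempty)
open import Data.Vec using (Vec; []; _∷_; lookup)
open import Data.List using (List; []; _∷_; _++_; map; length; filterᵇ; allFin)
open import Data.Bool.ListAction using (any)
open import Data.Product using (Σ; ∃; _×_; _,_)
open import Relation.Binary.PropositionalEquality using (_≡_)
open import Relation.Nullary.Decidable using (⌊_⌋)
open import Function.Definitions using (Injective)

allSubsets : (n : ℕ) → List (Subset n)
allSubsets zero = [] ∷ []
allSubsets (suc n) = map (true ∷_) (allSubsets n) ++ map (false ∷_) (allSubsets n)

record Hypergraph (k : ℕ) : Set where
  field
    nV      : ℕ
    edge    : Subset nV → Bool
    uniform : (e : Subset nV) → T (edge e) → ∣ e ∣ ≡ k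
open Hypergraph public

numEdges : ∀ {k} → Hypergraph k → ℕ
numEdges H = length (filterᵇ (edge H) (allSubsets (nV H)))

KPartite : ∀ {k} → Hypergraph k → Set
KPartite {k} H =
  Σ (Fin (nV H) → Fin k) λ part →
    (e : Subset (nV H)) → T (edge H e) →
      ((i : Fin k) → ∃ λ u → u ∈ e × part u ≡ i)
      × ((u v : Fin (nV H)) → u ∈ e → v ∈ e → part u ≡ part v → u ≡ v)

skelAdj : ∀ {k} (H : Hypergraph k) → Fin (nV H) → Fin (nV H) → Bool
skelAdj H u v =
  not ⌊ u ≟ v ⌋ ∧ any (λ e → edge H e ∧ lookup e u ∧ lookup e v) (allSubsets (nV H))

degIn : ∀ {k} (H : Hypergraph k) → Subset (nV H) → Fin (nV H) → ℕ
degIn H S v = length (filterᵇ (λ w → lookup S w ∧ skelAdj H v w) (allFin (nV H)))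

-- every (nonempty) subgraph of H^(1) has minimum degree at most d
-- (stated for induced subgraphs on vertex sets S; deleting edges only lowers degrees)
SkelDegenerate : ∀ {k} → Hypergraph k → ℕ → Set
SkelDegenerate H d =
  (S : Subset (nV H)) → Nonempty S → ∃ λ v → v ∈ S × degIn H S v ≤ d

IsSkelDegeneracy : ∀ {k} → Hypergraph k → ℕ → Set
IsSkelDegeneracy H d = SkelDegenerate H d × ((d' : ℕ) → SkelDegenerate H d' → d ≤ d')

-- G contains a copy of H: an injective vertex map sending every edge of H
-- into (hence, by uniformity and injectivity, onto) an edge of G
ContainsCopy : ∀ {k} → Hypergraph k → Hypergraph k → Set
ContainsCopy G H =
  Σ (Fin (nV H) → Fin (nV G)) λ φ →
    Injective _≡_ _≡_ φ ×
    ((e : Subset (nV H)) → T (edge H e) →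
      ∃ λ f → T (edge G f) × ((u : Fin (nV H)) → u ∈ e → φ u ∈ f))

{-# OPTIONS --safe #-}
module Submission where

open import Defs
open import Algebra.Properties.CommutativeSemigroup using (interchange)
open import Data.Bool using (Bool; true; false; T; _∧_; not; if_then_else_)
import Data.Bool.Properties as Bool
open import Data.Empty using (⊥-elim)
open import Data.Fin using (Fin; zero; suc; fromℕ<; punchOut)
open import Data.Fin.Properties using (_≟_; all?)
open import Data.Fin.Subset
  using (Subset; _∈_; _∉_; ∣_∣; Nonempty; _∪_; ⁅_⁆; _⊆_; _-_; ⊤) renaming (⊥ to ∅)
open import Data.Fin.Subset.Properties
  using (_∈?_; nonempty?; x∈p⇒∣p-x∣<∣p∣; x∈p∧x≢y⇒x∈p-y; p─q⊆p; ∈⊤; ∉⊥; ⊆-antisym;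
         p⊆p∪q; q⊆p∪q; x∈p∪q⁻; x∈⁅x⁆; x∈⁅y⁆⇒x≡y; ∪-identityˡ)
open import Data.List
  using (List; []; _∷_; _++_; length; map; allFin; filterᵇ; cartesianProductWith)
open import Data.List.Membership.Propositional using (lose) renaming (_∈_ to _∈ₗ_)
open import Data.List.Membership.Propositional.Properties
  using (∈-allFin; ∈-++⁺ˡ; ∈-++⁺ʳ; ∈-map⁺; ∈-map⁻; ∈-filter⁺; ∈-cartesianProductWith⁺)
open import Data.List.Properties using (map-cong; map-++; map-∘; length-tabulate)
open import Data.List.Relation.Unary.All using (All; []; _∷_)
open import Data.List.Relation.Unary.AllPairs using ([]; _∷_)
open import Data.List.Relation.Unary.Any using (here; there)
open import Data.List.Relation.Unary.Any.Properties using (any⁺)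
open import Data.List.Relation.Unary.Unique.Propositional using (Unique)
open import Data.List.Relation.Unary.Unique.Propositional.Properties using (map⁺; ++⁺; allFin⁺)
open import Data.Nat hiding (_≟_)
open import Data.Nat.ListAction using (sum)
open import Data.Nat.ListAction.Properties using (sum-++)
open import Data.Nat.Properties hiding (_≟_)
open import Data.Nat.Tactic.RingSolver using (solve-∀)
open import Data.Product using (∃; ∃₂; _×_; _,_; proj₁; proj₂)
open import Data.Sum using (inj₁; inj₂)
open import Data.Vec as Vec using (Vec; []; _∷_; lookup; removeAt; tabulate; _[_]≔_)
open import Data.Vec.Properties
  using (removeAt-punchOut; tabulate-cong; tabulate∘lookup; tabulate-∘; lookup∘tabulate; lookup-map;
         lookup-zipWith; lookup∘updateAt; lookup∘updateAt′; ≡-dec; ∷-injectiveʳ; []=⇒lookup)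
open import Function using (_∘_; Equivalence)
open import Relation.Binary.Definitions using (DecidableEquality)
open import Relation.Binary.PropositionalEquality
open import Relation.Nullary using (Dec; yes; no; does; ¬_; T?)
open import Relation.Nullary.Decidable using (⌊_⌋; dec-true; dec-false; map′; _→-dec_; _×-dec_)
open import Relation.Unary using (Decidable)

-- Take s = 2d and sample s vertices for each of the k parts. Density n^(-c/d^(k-1))
-- with c = 2^(-k) leaves, by convexity, at least C_H n^(ks - d) samples x all of whose
-- transversals are edges of G. Embed H greedily along a degeneracy order, keeping
-- the invariant that every edge of H stays an edge of G when its unembedded vertices
-- are replaced by arbitrary sample vertices from their parts. By the invariant all s sample
-- vertices of part i are admissible images for the next vertex v of part i, and
-- admissibility depends only on the at most d images of earlier neighbours of v and on
-- the other parts of x. So if at most m = |V(H)| images were admissible, part i of x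
-- would be one of m^s tuples, which happens for only O(n^(d + (k-1)s)) = O(n^(ks - d))
-- samples. For large C_H some sample therefore always leaves an admissible vertex that is still unused.

private variable
  A B : Set
  P : Set

-- Indicators and sums over finite lists.

⟦_⟧ : Dec P → ℕ
⟦ P? ⟧ = if does P? then 1 else 0

⟦⟧≤1 : (P? : Dec P) → ⟦ P? ⟧ ≤ 1
⟦⟧≤1 (yes _) = ≤-refl
⟦⟧≤1 (no _)  = z≤n

⟦⟧>0⇒ : (P? : Dec P) → 0 < ⟦ P? ⟧ → P
⟦⟧>0⇒ (yes p) _ = p

⇒⟦⟧>0 : (P? : Dec P) → P → 0 < ⟦ P? ⟧
⇒⟦⟧>0 (yes _) _ = ≤-refl
⇒⟦⟧>0 (no ¬p) p = ⊥-elim (¬p p)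

∑ : List A → (A → ℕ) → ℕ
∑ xs f = sum (map f xs)

∑-cong : (xs : List A) {f g : A → ℕ} → (∀ x → f x ≡ g x) → ∑ xs f ≡ ∑ xs g
∑-cong xs f≗g = cong sum (map-cong f≗g xs)

∑-mono : (xs : List A) {f g : A → ℕ} → (∀ x → f x ≤ g x) → ∑ xs f ≤ ∑ xs g
∑-mono []       f≤g = z≤n
∑-mono (x ∷ xs) f≤g = +-mono-≤ (f≤g x) (∑-mono xs f≤g)

∑-const : (xs : List A) (c : ℕ) → ∑ xs (λ _ → c) ≡ length xs * c
∑-const []       c = refl
∑-const (x ∷ xs) c = cong (c +_) (∑-const xs c)

∑-≤ : (xs : List A) {f : A → ℕ} {c : ℕ} → (∀ x → f x ≤ c) → ∑ xs f ≤ length xs * c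
∑-≤ xs {c = c} f≤c = ≤-trans (∑-mono xs f≤c) (≤-reflexive (∑-const xs c))

+-interchange : ∀ a b c d → (a + b) + (c + d) ≡ (a + c) + (b + d)
+-interchange = interchange +-commutativeSemigroup

*-interchange : ∀ a b c d → (a * b) * (c * d) ≡ (a * c) * (b * d)
*-interchange = interchange *-commutativeSemigroup

∑-+ : (xs : List A) (f g : A → ℕ) → ∑ xs (λ x → f x + g x) ≡ ∑ xs f + ∑ xs g
∑-+ []       f g = refl
∑-+ (x ∷ xs) f g rewrite ∑-+ xs f g = +-interchange (f x) (g x) (∑ xs f) (∑ xs g)

∑-*ˡ : (xs : List A) (c : ℕ) (f : A → ℕ) → ∑ xs (λ x → c * f x) ≡ c * ∑ xs f
∑-*ˡ []       c f = sym (*-zeroʳ c)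
∑-*ˡ (x ∷ xs) c f rewrite ∑-*ˡ xs c f = sym (*-distribˡ-+ c (f x) (∑ xs f))

∑-*ʳ : (xs : List A) (c : ℕ) (f : A → ℕ) → ∑ xs (λ x → f x * c) ≡ ∑ xs f * c
∑-*ʳ []       c f = refl
∑-*ʳ (x ∷ xs) c f rewrite ∑-*ʳ xs c f = sym (*-distribʳ-+ c (f x) (∑ xs f))

∑-swap : (xs : List A) (ys : List B) (f : A → B → ℕ) →
         ∑ xs (λ x → ∑ ys (f x)) ≡ ∑ ys (λ y → ∑ xs (λ x → f x y))
∑-swap []       ys f = sym (trans (∑-const ys 0) (*-zeroʳ (length ys)))
∑-swap (x ∷ xs) ys f =
  trans (cong (∑ ys (f x) +_) (∑-swap xs ys f))
        (sym (∑-+ ys (f x) (λ y → ∑ xs (λ x → f x y))))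

∑-++ : (xs ys : List A) (f : A → ℕ) → ∑ (xs ++ ys) f ≡ ∑ xs f + ∑ ys f
∑-++ xs ys f = trans (cong sum (map-++ f xs ys)) (sum-++ (map f xs) (map f ys))

∑-map : (g : A → B) (xs : List A) (f : B → ℕ) → ∑ (map g xs) f ≡ ∑ xs (f ∘ g)
∑-map g xs f = cong sum (sym (map-∘ xs))

∑-<⇒∃ : (xs : List A) (f g : A → ℕ) → ∑ xs f < ∑ xs g → ∃ λ x → f x < g x
∑-<⇒∃ (x ∷ xs) f g lt with f x <? g x
... | yes fx<gx = x , fx<gx
... | no  fx≮gx = ∑-<⇒∃ xs f g
                    (+-cancelˡ-< (g x) _ _ (≤-<-trans (+-monoˡ-≤ _ (≮⇒≥ fx≮gx)) lt))

∈⇒≤∑ : {xs : List A} {x : A} (f : A → ℕ) → x ∈ₗ xs → f x ≤ ∑ xs f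
∈⇒≤∑ f (here refl)       = m≤m+n _ _
∈⇒≤∑ f (there {y} x∈xs) = ≤-trans (∈⇒≤∑ f x∈xs) (m≤n+m _ (f y))

∑-cartesianProductWith : {C : Set} (h : A → B → C) (xs : List A) (ys : List B) (f : C → ℕ) →
  ∑ (cartesianProductWith h xs ys) f ≡ ∑ xs (λ x → ∑ ys (λ y → f (h x y)))
∑-cartesianProductWith h []       ys f = refl
∑-cartesianProductWith h (x ∷ xs) ys f =
  trans (∑-++ (map (h x) ys) _ f)
        (cong₂ _+_ (∑-map (h x) ys f) (∑-cartesianProductWith h xs ys f))

-- Rearrangement, Chebyshev and power-mean inequalities.

-- The right side exceeds the left by exactly `c * e`. Writing the larger base and power as `a + c`
-- and `p + e` avoids subtraction.
rearrangement′ : ∀ a c p e → a * (p + e) + (a + c) * p ≤ a * p + (a + c) * (p + e)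
rearrangement′ a c p e = ≤-trans (m≤m+n _ (c * e)) (≤-reflexive (identity a c p e))
  where
  identity : ∀ a c p e → a * (p + e) + (a + c) * p + c * e ≡ a * p + (a + c) * (p + e)
  identity = solve-∀

rearrangement-≤ : ∀ {a b} t → a ≤ b → a * b ^ t + b * a ^ t ≤ a * a ^ t + b * b ^ t
rearrangement-≤ {a} {b} t a≤b =
  subst₂ (λ b p → a * p + b * a ^ t ≤ a * a ^ t + b * p)
    (m+[n∸m]≡n a≤b) (m+[n∸m]≡n (^-monoˡ-≤ t a≤b))
    (rearrangement′ a (b ∸ a) (a ^ t) (b ^ t ∸ a ^ t))

rearrangement : ∀ a b t → a * b ^ t + b * a ^ t ≤ a * a ^ t + b * b ^ t
rearrangement a b t with ≤-total a b
... | inj₁ a≤b = rearrangement-≤ t a≤b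
... | inj₂ b≤a = subst₂ _≤_ (+-comm (b * a ^ t) _) (+-comm (b * b ^ t) _) (rearrangement-≤ t b≤a)

-- Chebyshev's sum inequality for the similarly ordered `f` and `f ^ t`. A new element creates cross
-- terms with each old one, and `rearrangement` bounds these pair by pair.
chebyshev : (xs : List A) (f : A → ℕ) (t : ℕ) →
  ∑ xs f * ∑ xs (λ x → f x ^ t) ≤ length xs * ∑ xs (λ x → f x ^ suc t)
chebyshev []       f t = z≤n
chebyshev (x ∷ xs) f t = begin
  (a + F) * (p + G)                   ≡⟨ expand a F p G ⟩
  a * p + (a * G + F * p) + F * G     ≤⟨ +-mono-≤ (+-monoʳ-≤ (a * p) cross) (chebyshev xs f t) ⟩
  a * p + (L * (a * p) + H) + L * H   ≡⟨ collect a p L H ⟩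
  suc L * (a * p + H)                 ∎
  where
  open ≤-Reasoning
  a F p G H L : ℕ
  a = f x
  F = ∑ xs f
  p = f x ^ t
  G = ∑ xs (λ y → f y ^ t)
  H = ∑ xs (λ y → f y ^ suc t)
  L = length xs
  expand : ∀ a F p G → (a + F) * (p + G) ≡ a * p + (a * G + F * p) + F * G
  expand = solve-∀
  collect : ∀ a p L H → a * p + (L * (a * p) + H) + L * H ≡ suc L * (a * p + H)
  collect = solve-∀
  cross : a * G + F * p ≤ L * (a * p) + H
  cross = begin
    a * G + F * p                                 ≡⟨ cong₂ _+_ (∑-*ˡ xs a _) (∑-*ʳ xs p f) ⟨
    ∑ xs (λ y → a * f y ^ t) + ∑ xs (λ y → f y * p) ≡⟨ ∑-+ xs _ _ ⟨
    ∑ xs (λ y → a * f y ^ t + f y * p)            ≤⟨ ∑-mono xs (λ y → rearrangement a (f y) t) ⟩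
    ∑ xs (λ y → a * p + f y ^ suc t)              ≡⟨ ∑-+ xs _ _ ⟩
    ∑ xs (λ y → a * p) + H                        ≡⟨ cong (_+ H) (∑-const xs (a * p)) ⟩
    L * (a * p) + H                               ∎

-- Jensen's inequality for `t`-th powers, by iterating `chebyshev`. The factor `length xs` on the
-- left replaces an exponent `t - 1` on the right, so `t = 0` is covered too.
power-mean : (xs : List A) (f : A → ℕ) (t : ℕ) →
  ∑ xs f ^ t * length xs ≤ length xs ^ t * ∑ xs (λ x → f x ^ t)
power-mean xs f zero    =
  ≤-reflexive (cong (1 *_) (sym (trans (∑-const xs 1) (*-identityʳ _))))
power-mean xs f (suc t) = begin
  F * F ^ t * L                             ≡⟨ *-assoc F _ L ⟩
  F * (F ^ t * L)                           ≤⟨ *-monoʳ-≤ F (power-mean xs f t) ⟩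
  F * (L ^ t * ∑ xs (λ x → f x ^ t))        ≡⟨ reorder F (L ^ t) _ ⟩
  L ^ t * (F * ∑ xs (λ x → f x ^ t))        ≤⟨ *-monoʳ-≤ (L ^ t) (chebyshev xs f t) ⟩
  L ^ t * (L * ∑ xs (λ x → f x ^ suc t))    ≡⟨ regroup (L ^ t) L _ ⟩
  L * L ^ t * ∑ xs (λ x → f x ^ suc t)      ∎
  where
  open ≤-Reasoning
  F L : ℕ
  F = ∑ xs f
  L = length xs
  reorder : ∀ a b c → a * (b * c) ≡ b * (a * c)
  reorder = solve-∀
  regroup : ∀ a b c → a * (b * c) ≡ b * a * c
  regroup = solve-∀

-- Tuples, products over tuples, and blow-ups.

vecs : List A → (k : ℕ) → List (Vec A k)
vecs xs zero    = [] ∷ []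
vecs xs (suc k) = cartesianProductWith _∷_ xs (vecs xs k)

∑-vecs-suc : (xs : List A) (k : ℕ) (f : Vec A (suc k) → ℕ) →
  ∑ (vecs xs (suc k)) f ≡ ∑ xs (λ x → ∑ (vecs xs k) (λ v → f (x ∷ v)))
∑-vecs-suc xs k f = ∑-cartesianProductWith _∷_ xs (vecs xs k) f

length-as-∑ : (xs : List A) → length xs ≡ ∑ xs (λ _ → 1)
length-as-∑ xs = sym (trans (∑-const xs 1) (*-identityʳ _))

length-vecs : (xs : List A) (k : ℕ) → length (vecs xs k) ≡ length xs ^ k
length-vecs xs zero    = refl
length-vecs xs (suc k) = begin
  length (vecs xs (suc k))                   ≡⟨ length-as-∑ (vecs xs (suc k)) ⟩
  ∑ (vecs xs (suc k)) (λ _ → 1)              ≡⟨ ∑-vecs-suc xs k _ ⟩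
  ∑ xs (λ _ → ∑ (vecs xs k) (λ _ → 1))       ≡⟨ ∑-const xs _ ⟩
  length xs * ∑ (vecs xs k) (λ _ → 1)        ≡⟨ cong (length xs *_) (length-as-∑ (vecs xs k)) ⟨
  length xs * length (vecs xs k)             ≡⟨ cong (length xs *_) (length-vecs xs k) ⟩
  length xs * length xs ^ k                  ∎
  where open ≡-Reasoning

∈-vecs : {xs : List A} → (∀ x → x ∈ₗ xs) → ∀ {k} (v : Vec A k) → v ∈ₗ vecs xs k
∈-vecs all []      = here refl
∈-vecs all (x ∷ v) = ∈-cartesianProductWith⁺ _∷_ (all x) (∈-vecs all v)

∏ : (A → ℕ) → ∀ {s} → Vec A s → ℕ
∏ f []      = 1
∏ f (x ∷ v) = f x * ∏ f v

-- For 0/1 weights this reads the `s`-th power of a degree as a number of `s`-tuples.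
∑-∏ : (xs : List A) (f : A → ℕ) (s : ℕ) → ∑ (vecs xs s) (∏ f) ≡ ∑ xs f ^ s
∑-∏ xs f zero    = refl
∑-∏ xs f (suc s) = begin
  ∑ (vecs xs (suc s)) (∏ f)                  ≡⟨ ∑-vecs-suc xs s _ ⟩
  ∑ xs (λ x → ∑ (vecs xs s) (λ v → f x * ∏ f v)) ≡⟨ ∑-cong xs (λ x → ∑-*ˡ (vecs xs s) (f x) (∏ f)) ⟩
  ∑ xs (λ x → f x * ∑ (vecs xs s) (∏ f))     ≡⟨ ∑-*ʳ xs _ f ⟩
  ∑ xs f * ∑ (vecs xs s) (∏ f)               ≡⟨ cong (∑ xs f *_) (∑-∏ xs f s) ⟩
  ∑ xs f * ∑ xs f ^ s                        ∎
  where open ≡-Reasoning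

∏≤1 : (f : A → ℕ) → (∀ x → f x ≤ 1) → ∀ {s} (v : Vec A s) → ∏ f v ≤ 1
∏≤1 f f≤1 []      = ≤-refl
∏≤1 f f≤1 (x ∷ v) = *-mono-≤ (f≤1 x) (∏≤1 f f≤1 v)

*>0⇒ : ∀ m {n} → 0 < m * n → 0 < m × 0 < n
*>0⇒ (suc m) {zero}  p rewrite *-zeroʳ m = ⊥-elim (n≮0 p)
*>0⇒ (suc m) {suc n} p = z<s , z<s

∏>0⇒ : (f : A → ℕ) → ∀ {s} (v : Vec A s) → 0 < ∏ f v → ∀ i → 0 < f (lookup v i)
∏>0⇒ f (x ∷ v) p zero    = proj₁ (*>0⇒ (f x) p)
∏>0⇒ f (x ∷ v) p (suc i) = ∏>0⇒ f v (proj₂ (*>0⇒ (f x) p)) i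

⇒∏>0 : (f : A → ℕ) → ∀ {s} (v : Vec A s) → (∀ i → 0 < f (lookup v i)) → 0 < ∏ f v
⇒∏>0 f []      p = z<s
⇒∏>0 f (x ∷ v) p = *-mono-≤ (p zero) (⇒∏>0 f v (p ∘ suc))

-- For 0/1 weights, blowup k w x is 1 exactly when x spans a complete
-- k-partite pattern with s vertices in each part.
blowup : ∀ {s} k → (Vec A k → ℕ) → Vec (Vec A s) k → ℕ
blowup zero    w []      = w []
blowup (suc k) w (z ∷ x) = blowup k (λ v → ∏ (λ y → w (y ∷ v)) z) x

blowup≤1 : ∀ {s} k (w : Vec A k → ℕ) → (∀ v → w v ≤ 1) → (x : Vec (Vec A s) k) → blowup k w x ≤ 1
blowup≤1 zero    w w≤1 []      = w≤1 []
blowup≤1 (suc k) w w≤1 (z ∷ x) = blowup≤1 k _ (λ v → ∏≤1 _ (λ y → w≤1 (y ∷ v)) z) x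

select : ∀ {s k} → Vec (Vec A s) k → Vec (Fin s) k → Vec A k
select = Vec.zipWith lookup

blowup>0⇒ : ∀ {s} k (w : Vec A k → ℕ) (x : Vec (Vec A s) k) → 0 < blowup k w x →
  (a : Vec (Fin s) k) → 0 < w (select x a)
blowup>0⇒ zero    w []      p []      = p
blowup>0⇒ (suc k) w (z ∷ x) p (i ∷ a) =
  ∏>0⇒ (λ y → w (y ∷ select x a)) z (blowup>0⇒ k _ x p a) i

^-distribʳ-* : ∀ m a b → (a * b) ^ m ≡ a ^ m * b ^ m
^-distribʳ-* zero    a b = refl
^-distribʳ-* (suc m) a b =
  trans (cong (a * b *_) (^-distribʳ-* m a b)) (*-interchange a b (a ^ m) (b ^ m))

-- Sidorenko's inequality for complete k-partite hypergraphs, cleared of denominators.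
blowup-count : ∀ (V : List A) (s k : ℕ) (w : Vec A k → ℕ) → .{{_ : NonZero (length V)}} →
  ∑ (vecs V k) w ^ (s ^ k) * length V ^ (k * s)
    ≤ ∑ (vecs (vecs V s) k) (blowup k w) * length V ^ (k * s ^ k)
blowup-count V s zero    w = ≤-reflexive (cong (_* 1) (*-identityʳ (w [] + 0)))
-- The factor `n ^ (k * t)` is what `first` consumes when raised to the power `t`; it cancels
-- because `n` is positive.
blowup-count {A = A} V s (suc k) w = *-cancelʳ-≤ _ _ (n ^ (k * t)) {{m^n≢0 n (k * t)}} (begin
  N ^ (s * t) * n ^ (s + k * s) * n ^ (k * t)
    ≡⟨ cong₂ (λ a b → a * b * n ^ (k * t)) (sym (^-*-assoc N s t)) (^-distribˡ-+-* n s (k * s)) ⟩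
  (N ^ s) ^ t * (n ^ s * n ^ (k * s)) * n ^ (k * t)
    ≡⟨ cong (λ a → (N ^ s) ^ t * (n ^ s * n ^ (k * s)) * a) (sym (^-*-assoc n k t)) ⟩
  (N ^ s) ^ t * (n ^ s * n ^ (k * s)) * (n ^ k) ^ t
    ≡⟨ shuffle₁ ((N ^ s) ^ t) (n ^ s) (n ^ (k * s)) ((n ^ k) ^ t) ⟩
  (N ^ s) ^ t * (n ^ k) ^ t * n ^ s * n ^ (k * s)
    ≡⟨ cong (λ a → a * n ^ s * n ^ (k * s)) (^-distribʳ-* t (N ^ s) (n ^ k)) ⟨
  (N ^ s * n ^ k) ^ t * n ^ s * n ^ (k * s)
    ≤⟨ *-monoˡ-≤ (n ^ (k * s)) (*-monoˡ-≤ (n ^ s) (^-monoˡ-≤ t first)) ⟩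
  ((n ^ k) ^ s * Q) ^ t * n ^ s * n ^ (k * s)
    ≡⟨ cong (λ a → a * n ^ s * n ^ (k * s)) (^-distribʳ-* t ((n ^ k) ^ s) Q) ⟩
  ((n ^ k) ^ s) ^ t * Q ^ t * n ^ s * n ^ (k * s)
    ≡⟨ cong (_* n ^ (k * s)) (*-assoc (((n ^ k) ^ s) ^ t) (Q ^ t) (n ^ s)) ⟩
  ((n ^ k) ^ s) ^ t * (Q ^ t * n ^ s) * n ^ (k * s)
    ≤⟨ *-monoˡ-≤ (n ^ (k * s)) (*-monoʳ-≤ (((n ^ k) ^ s) ^ t) second) ⟩
  ((n ^ k) ^ s) ^ t * ((n ^ s) ^ t * M) * n ^ (k * s)
    ≡⟨ shuffle₂ (((n ^ k) ^ s) ^ t) ((n ^ s) ^ t) M (n ^ (k * s)) ⟩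
  ((n ^ k) ^ s) ^ t * (n ^ s) ^ t * (M * n ^ (k * s))
    ≤⟨ *-monoʳ-≤ (((n ^ k) ^ s) ^ t * (n ^ s) ^ t) third ⟩
  ((n ^ k) ^ s) ^ t * (n ^ s) ^ t * (K * n ^ (k * t))
    ≡⟨ shuffle₃ (((n ^ k) ^ s) ^ t) ((n ^ s) ^ t) K (n ^ (k * t)) ⟩
  K * ((n ^ s) ^ t * ((n ^ k) ^ s) ^ t) * n ^ (k * t)
    ≡⟨ cong (λ a → K * a * n ^ (k * t)) exponents ⟩
  K * n ^ (s * t + k * (s * t)) * n ^ (k * t) ∎)
  where
  open ≤-Reasoning
  n t N K Q M : ℕ
  n = length V
  t = s ^ k
  N = ∑ (vecs V (suc k)) w
  K = ∑ (vecs (vecs V s) (suc k)) (blowup (suc k) w)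
  link : Vec A s → Vec A k → ℕ
  link z v = ∏ (λ y → w (y ∷ v)) z
  Q = ∑ (vecs V s) (λ z → ∑ (vecs V k) (link z))
  M = ∑ (vecs V s) (λ z → ∑ (vecs V k) (link z) ^ t)
  deg : Vec A k → ℕ
  deg v = ∑ V (λ y → w (y ∷ v))
  shuffle₁ : ∀ a b c d → a * (b * c) * d ≡ a * d * b * c
  shuffle₁ = solve-∀
  shuffle₂ : ∀ a b c d → a * (b * c) * d ≡ a * b * (c * d)
  shuffle₂ = solve-∀
  shuffle₃ : ∀ a b c d → a * b * (c * d) ≡ c * (b * a) * d
  shuffle₃ = solve-∀
  exponents : (n ^ s) ^ t * ((n ^ k) ^ s) ^ t ≡ n ^ (s * t + k * (s * t))
  exponents = begin-equality
    (n ^ s) ^ t * ((n ^ k) ^ s) ^ t  ≡⟨ cong₂ _*_ (^-*-assoc n s t) (^-*-assoc (n ^ k) s t) ⟩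
    n ^ (s * t) * (n ^ k) ^ (s * t)  ≡⟨ cong (n ^ (s * t) *_) (^-*-assoc n k (s * t)) ⟩
    n ^ (s * t) * n ^ (k * (s * t))  ≡⟨ ^-distribˡ-+-* n (s * t) (k * (s * t)) ⟨
    n ^ (s * t + k * (s * t))        ∎
  -- Convexity over the last `k` coordinates: the first vertex becomes an `s`-tuple `z` of vertices
  -- sharing the same `v`.
  first : N ^ s * n ^ k ≤ (n ^ k) ^ s * Q
  first = begin
    N ^ s * n ^ k
      ≡⟨ cong₂ (λ a b → a ^ s * b) (trans (∑-vecs-suc V k w) (∑-swap V (vecs V k) _)) (sym (length-vecs V k)) ⟩
    ∑ (vecs V k) deg ^ s * length (vecs V k)
      ≤⟨ power-mean (vecs V k) deg s ⟩
    length (vecs V k) ^ s * ∑ (vecs V k) (λ v → deg v ^ s)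
      ≡⟨ cong₂ (λ a b → a ^ s * b) (length-vecs V k)
           (∑-cong (vecs V k) (λ v → sym (∑-∏ V (λ y → w (y ∷ v)) s))) ⟩
    (n ^ k) ^ s * ∑ (vecs V k) (λ v → ∑ (vecs V s) (λ z → link z v))
      ≡⟨ cong ((n ^ k) ^ s *_) (∑-swap (vecs V k) (vecs V s) _) ⟩
    (n ^ k) ^ s * Q ∎
  -- Convexity over `z`, with the exponent `t` that the induction hypothesis requires.
  second : Q ^ t * n ^ s ≤ (n ^ s) ^ t * M
  second = subst (λ a → Q ^ t * a ≤ a ^ t * M) (length-vecs V s) (power-mean (vecs V s) _ t)
  -- Induction, applied to the common link of each `z`.
  third : M * n ^ (k * s) ≤ K * n ^ (k * t)
  third = begin
    M * n ^ (k * s)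
      ≡⟨ ∑-*ʳ (vecs V s) _ _ ⟨
    ∑ (vecs V s) (λ z → ∑ (vecs V k) (link z) ^ t * n ^ (k * s))
      ≤⟨ ∑-mono (vecs V s) (λ z → blowup-count V s k (link z)) ⟩
    ∑ (vecs V s) (λ z → ∑ (vecs (vecs V s) k) (blowup k (link z)) * n ^ (k * t))
      ≡⟨ ∑-*ʳ (vecs V s) _ _ ⟩
    ∑ (vecs V s) (λ z → ∑ (vecs (vecs V s) k) (blowup k (link z))) * n ^ (k * t)
      ≡⟨ cong (_* n ^ (k * t)) (∑-vecs-suc (vecs V s) k _) ⟨
    K * n ^ (k * t) ∎

-- Fibrewise counting, indicator bounds and finite decidability.

-- Coordinate `i` is summed first with the rest frozen: each fibre costs at most `c`, and there are
-- `length xs ^ k` fibres.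
∑-fibre-≤ : (xs : List A) (k : ℕ) (i : Fin (suc k)) (g : Vec A k → A → ℕ) (c : ℕ) →
  (∀ v → ∑ xs (g v) ≤ c) →
  ∑ (vecs xs (suc k)) (λ v → g (removeAt v i) (lookup v i)) ≤ length xs ^ k * c
∑-fibre-≤ xs k zero g c g≤c = begin
  ∑ (vecs xs (suc k)) (λ v → g (removeAt v zero) (lookup v zero)) ≡⟨ ∑-vecs-suc xs k _ ⟩
  ∑ xs (λ y → ∑ (vecs xs k) (λ v → g v y))   ≡⟨ ∑-swap xs (vecs xs k) _ ⟩
  ∑ (vecs xs k) (λ v → ∑ xs (g v))           ≤⟨ ∑-≤ (vecs xs k) g≤c ⟩
  length (vecs xs k) * c                     ≡⟨ cong (_* c) (length-vecs xs k) ⟩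
  length xs ^ k * c                          ∎
  where open ≤-Reasoning
∑-fibre-≤ xs (suc k) (suc i) g c g≤c = begin
  ∑ (vecs xs (suc (suc k))) (λ v → g (removeAt v (suc i)) (lookup v (suc i)))
    ≡⟨ ∑-vecs-suc xs (suc k) _ ⟩
  ∑ xs (λ y → ∑ (vecs xs (suc k)) (λ v → g (removeAt (y ∷ v) (suc i)) (lookup v i)))
    -- `removeAt` unfolds at a successor index only once the tail is a visible cons.
    ≡⟨ ∑-cong xs (λ y → ∑-cong (vecs xs (suc k)) (λ { v@(_ ∷ _) → refl })) ⟩
  ∑ xs (λ y → ∑ (vecs xs (suc k)) (λ v → g (y ∷ removeAt v i) (lookup v i)))
    ≤⟨ ∑-≤ xs (λ y → ∑-fibre-≤ xs k i (g ∘ (y ∷_)) c (g≤c ∘ (y ∷_))) ⟩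
  length xs * (length xs ^ k * c)
    ≡⟨ *-assoc (length xs) _ c ⟨
  length xs ^ suc k * c ∎
  where open ≤-Reasoning

if-yes : (P? : Dec P) {a b : A} → P → (if does P? then a else b) ≡ a
if-yes P? {a} {b} p = cong (if_then a else b) (dec-true P? p)

if-no : (P? : Dec P) {a b : A} → ¬ P → (if does P? then a else b) ≡ b
if-no P? {a} {b} ¬p = cong (if_then a else b) (dec-false P? ¬p)

∑-unique : (_≟ₐ_ : DecidableEquality A) {xs : List A} → Unique xs → ∀ y → ∑ xs (λ x → ⟦ y ≟ₐ x ⟧) ≤ 1
∑-unique _≟ₐ_ []                 y = z≤n
∑-unique _≟ₐ_ (_∷_ {x} {xs} x∉xs u) y with y ≟ₐ x
... | no _     = ∑-unique _≟ₐ_ u y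
... | yes refl = s≤s (absent xs x∉xs)
  where
  absent : ∀ xs → All (y ≢_) xs → ∑ xs (λ x → ⟦ y ≟ₐ x ⟧) ≤ 0
  absent []       []          = z≤n
  absent (x ∷ xs) (y≢x ∷ ne) rewrite if-no (y ≟ₐ x) {1} {0} y≢x = absent xs ne

⟦⟧*-≤ : (P? : Dec P) {t u : ℕ} → (P → t ≤ u) → ⟦ P? ⟧ * t ≤ u
⟦⟧*-≤ (yes p) t≤u = ≤-trans (≤-reflexive (*-identityˡ _)) (t≤u p)
⟦⟧*-≤ (no _)  _   = z≤n

⟦⟧*≡0⇒¬ : (P? : Dec P) {t : ℕ} → ⟦ P? ⟧ * t ≡ 0 → 0 < t → ¬ P
⟦⟧*≡0⇒¬ P? {t} eq t>0 p = <⇒≢ (*-mono-< (⇒⟦⟧>0 P? p) t>0) (sym eq)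

length-allFin : ∀ n → length (allFin n) ≡ n
length-allFin n = length-tabulate {n = n} (λ i → i)

∈-allSubsets : ∀ {m} (S : Subset m) → S ∈ₗ allSubsets m
∈-allSubsets []          = here refl
∈-allSubsets (true ∷ S)  = ∈-++⁺ˡ (∈-map⁺ (true ∷_) (∈-allSubsets S))
∈-allSubsets (false ∷ S) = ∈-++⁺ʳ _ (∈-map⁺ (false ∷_) (∈-allSubsets S))

∀vec? : ∀ {m k} {P : Vec (Fin m) k → Set} → Decidable P → Dec (∀ v → P v)
∀vec? {k = zero}  P? = map′ (λ { p [] → p }) (λ f → f []) (P? [])
∀vec? {k = suc k} P? =
  map′ (λ { f (i ∷ v) → f i v }) (λ f i v → f (i ∷ v)) (all? (λ i → ∀vec? (P? ∘ (i ∷_))))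

x∉p-x : ∀ {m} (p : Subset m) x → x ∉ p - x
x∉p-x (true  ∷ p) zero    ()
x∉p-x (false ∷ p) zero    ()
x∉p-x (_ ∷ p)     (suc x) (Vec.there h) = x∉p-x p x h

-- Bad events of the greedy embedding and their number.

module GreedyEmbedding {n m k s d : ℕ} (part : Fin m → Fin (suc k))
  {E : Vec (Fin m) (suc k) → Set} (E? : Decidable E)
  {R : Vec (Fin n) (suc k) → Set} (R? : Decidable R)
  (nbrs : Subset m → Fin m → List (Fin m)) (y₀ : Fin n) where

  V : List (Fin n)
  V = allFin n

  assign : ∀ {d} → List (Fin m) → Vec (Fin n) d → Fin m → Fin n
  assign (w ∷ ws) (y ∷ σ) u = if does (u ≟ w) then y else assign ws σ u
  assign _        _       u = y₀

  -- Lets vectors of length `d` stand for every map on at most `d` neighbours, so a union bound runs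
  -- over `n ^ d` contexts instead of all partial embeddings. Spare entries are padded with `y₀`.
  assign-surjective : ∀ {d} (φ : Fin m → Fin n) (ws : List (Fin m)) → length ws ≤ d →
    ∃ λ (σ : Vec (Fin n) d) → ∀ {u} → u ∈ₗ ws → assign ws σ u ≡ φ u
  assign-surjective φ []       _ = Vec.replicate _ y₀ , λ ()
  assign-surjective φ (w ∷ ws) (s≤s len) with assign-surjective φ ws len
  ... | σ , eq = φ w ∷ σ , go
    where
    go : ∀ {u} → u ∈ₗ w ∷ ws → assign (w ∷ ws) (φ w ∷ σ) u ≡ φ u
    go {u} u∈ with u ≟ w
    go u∈           | yes refl = refl
    go (here u≡w)   | no u≢w   = ⊥-elim (u≢w u≡w)
    go (there u∈ws) | no _     = eq u∈ws

  -- The would-be image of an edge c through v: v goes to z, the other vertices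
  -- in S are mapped by σ, and those outside S are filled in from the sample x.
  slot : (S : Subset m) (v : Fin m) (σ : Vec (Fin n) d) (x : Vec (Vec (Fin n) s) k) (z : Fin n) →
         Vec (Fin m) (suc k) → Vec (Fin s) (suc k) → Fin (suc k) → Fin n
  slot S v σ x z c a i with part v ≟ i
  ... | yes _  = z
  ... | no p≢i = if does (lookup c i ∈? S) then assign (nbrs S v) σ (lookup c i)
                 else lookup (lookup x (punchOut p≢i)) (lookup a i)

  -- Here `x` has only `k` rows: the row of `v` itself is left out. Admissibility of `z` is thus
  -- independent of that row, which can be counted with everything else fixed.
  Extends : Subset m → Fin m → Vec (Fin n) d → Vec (Vec (Fin n) s) k → Fin n → Set
  Extends S v σ x z =
    ∀ c → E c → lookup c (part v) ≡ v → ∀ a → R (tabulate (slot S v σ x z c a))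

  abstract
    extends? : ∀ S v σ x → Decidable (Extends S v σ x)
    extends? S v σ x z =
      ∀vec? (λ c → E? c →-dec (lookup c (part v) ≟ v →-dec ∀vec? (λ a → R? (tabulate (slot S v σ x z c a)))))

  codegree : Subset m → Fin m → Vec (Fin n) d → Vec (Vec (Fin n) s) k → ℕ
  codegree S v σ x = ∑ V (λ z → ⟦ extends? S v σ x z ⟧)

  -- Indicates the dangerous event: all of the row `zs` is admissible, yet at most `m` vertices are,
  -- so all of these might already be used.
  starved : Subset m → Fin m → Vec (Fin n) d → Vec (Vec (Fin n) s) k → Vec (Fin n) s → ℕ
  starved S v σ x zs = ⟦ codegree S v σ x ≤? m ⟧ * ∏ (λ z → ⟦ extends? S v σ x z ⟧) zs

  bad : Subset m → Fin m → Vec (Fin n) d → Vec (Vec (Fin n) s) (suc k) → ℕ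
  bad S v σ x = starved S v σ (removeAt x (part v)) (lookup x (part v))

  -- The first indicator vanishes unless at most `m` vertices are admissible, and then `zs` is an
  -- `s`-tuple of such vertices.
  starved-count : ∀ S v σ x → ∑ (vecs V s) (starved S v σ x) ≤ m ^ s
  starved-count S v σ x = begin
    ∑ (vecs V s) (starved S v σ x)                     ≡⟨ ∑-*ˡ (vecs V s) ⟦ codegree S v σ x ≤? m ⟧ _ ⟩
    ⟦ codegree S v σ x ≤? m ⟧ * ∑ (vecs V s) (∏ _)     ≡⟨ cong (⟦ codegree S v σ x ≤? m ⟧ *_) (∑-∏ V _ s) ⟩
    ⟦ codegree S v σ x ≤? m ⟧ * codegree S v σ x ^ s   ≤⟨ ⟦⟧*-≤ (codegree S v σ x ≤? m) (^-monoˡ-≤ s) ⟩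
    m ^ s                                              ∎
    where open ≤-Reasoning

  -- Ranging over all `S`, `v` and `σ`, whether or not the greedy process meets them, costs only
  -- `n ^ d` times a factor depending on `m`.
  badTotal : Vec (Vec (Fin n) s) (suc k) → ℕ
  badTotal x = ∑ (allSubsets m) (λ S → ∑ (allFin m) (λ v → ∑ (vecs V d) (λ σ → bad S v σ x)))

  badTotal-count : ∑ (vecs (vecs V s) (suc k)) badTotal
    ≤ length (allSubsets m) * (m * (n ^ d * ((n ^ s) ^ k * m ^ s)))
  badTotal-count = begin
    ∑ X badTotal
      ≡⟨ ∑-swap X (allSubsets m) _ ⟩
    ∑ (allSubsets m) (λ S → ∑ X (λ x → ∑ (allFin m) (λ v → ∑ (vecs V d) (λ σ → bad S v σ x))))
      ≤⟨ ∑-≤ (allSubsets m) (λ S → begin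
        ∑ X (λ x → ∑ (allFin m) (λ v → ∑ (vecs V d) (λ σ → bad S v σ x)))
          ≡⟨ ∑-swap X (allFin m) _ ⟩
        ∑ (allFin m) (λ v → ∑ X (λ x → ∑ (vecs V d) (λ σ → bad S v σ x)))
          ≤⟨ ∑-≤ (allFin m) (λ v → begin
            ∑ X (λ x → ∑ (vecs V d) (λ σ → bad S v σ x))
              ≡⟨ ∑-swap X (vecs V d) _ ⟩
            ∑ (vecs V d) (λ σ → ∑ X (bad S v σ))
              -- With the other rows fixed, at most `m ^ s` of the `n ^ s` rows at `part v` are
              -- starved. Once `s = 2 * d`, this saving pays for the `n ^ d` choices of `σ`.
              ≤⟨ ∑-≤ (vecs V d) (λ σ → ∑-fibre-≤ (vecs V s) k (part v) (starved S v σ) (m ^ s) (starved-count S v σ)) ⟩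
            length (vecs V d) * (length (vecs V s) ^ k * m ^ s)
              ≡⟨ cong₂ (λ a b → a * (b ^ k * m ^ s)) (length-vecs-V d) (length-vecs-V s) ⟩
            n ^ d * ((n ^ s) ^ k * m ^ s) ∎) ⟩
        length (allFin m) * (n ^ d * ((n ^ s) ^ k * m ^ s))
          ≡⟨ cong (_* (n ^ d * ((n ^ s) ^ k * m ^ s))) (length-allFin m) ⟩
        m * (n ^ d * ((n ^ s) ^ k * m ^ s)) ∎) ⟩
    length (allSubsets m) * (m * (n ^ d * ((n ^ s) ^ k * m ^ s))) ∎
    where
    open ≤-Reasoning
    X : List (Vec (Vec (Fin n) s) (suc k))
    X = vecs (vecs V s) (suc k)
    length-vecs-V : ∀ t → length (vecs V t) ≡ n ^ t
    length-vecs-V t = trans (length-vecs V t) (cong (_^ t) (length-allFin n))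

  bad≤badTotal : ∀ S v σ x → bad S v σ x ≤ badTotal x
  bad≤badTotal S v σ x =
    ≤-trans (∈⇒≤∑ (λ σ → bad S v σ x) (∈-vecs ∈-allFin σ))
      (≤-trans (∈⇒≤∑ (λ v → ∑ (vecs V d) (λ σ → bad S v σ x)) (∈-allFin v))
        (∈⇒≤∑ (λ S → ∑ (allFin m) (λ v → ∑ (vecs V d) (λ σ → bad S v σ x))) (∈-allSubsets S)))

  -- Greedy embedding into a sample free of bad events.

  module _
    (E-part : ∀ {c} → E c → ∀ i → part (lookup c i) ≡ i)
    (nbrs-complete : ∀ {c} → E c → ∀ S v i → lookup c (part v) ≡ v → part v ≢ i →
                     lookup c i ∈ S → lookup c i ∈ₗ nbrs S v)
    (degenerate : ∀ S → Nonempty S → ∃ λ v → v ∈ S × length (nbrs S v) ≤ d)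
    (x : Vec (Vec (Fin n) s) (suc k))
    (complete : ∀ a → R (select x a))
    (no-bad : badTotal x ≡ 0)
    where

    mix : Subset m → (Fin m → Fin n) → Vec (Fin m) (suc k) → Vec (Fin s) (suc k) → Fin (suc k) → Fin n
    mix S φ c a i =
      if does (lookup c i ∈? S) then φ (lookup c i) else lookup (lookup x i) (lookup a i)

    -- `φ` is total, but both conditions read it only on `S`, so its values elsewhere are arbitrary.
    record Partial (S : Subset m) : Set where
      field
        φ    : Fin m → Fin n
        inj  : ∀ {u u′} → u ∈ S → u′ ∈ S → φ u ≡ φ u′ → u ≡ u′
        fits : ∀ c → E c → ∀ a → R (tabulate (mix S φ c a))

    empty-partial : ∀ S → ¬ Nonempty S → Partial S
    empty-partial S empty = record
      { φ    = λ _ → y₀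
      ; inj  = λ {u} u∈S _ _ → ⊥-elim (empty (u , u∈S))
      ; fits = λ c _ a → subst R (trans (sym (tabulate∘lookup (select x a))) (tabulate-cong (filled c a))) (complete a)
      }
      where
      filled : ∀ c a i → lookup (select x a) i ≡ mix S (λ _ → y₀) c a i
      filled c a i = trans (lookup-zipWith lookup i x a)
        (sym (if-no (lookup c i ∈? S) (λ ∈S → empty (lookup c i , ∈S))))

    -- Since `badTotal x` is zero, so is the product defining `bad S v σ x`. Its second factor is
    -- positive by `ext`, so the first must vanish.
    many-extensions : ∀ S v σ → (∀ b → Extends S v σ (removeAt x (part v)) (lookup (lookup x (part v)) b)) →
      m < codegree S v σ (removeAt x (part v))
    many-extensions S v σ ext = ≰⇒>
      (⟦⟧*≡0⇒¬ (codegree S v σ (removeAt x (part v)) ≤? m)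
        (n≤0⇒n≡0 (subst (bad S v σ x ≤_) no-bad (bad≤badTotal S v σ x)))
        (⇒∏>0 _ (lookup x (part v)) (λ b → ⇒⟦⟧>0 (extends? S v σ _ _) (ext b))))

    -- Pigeonhole by averaging: `φ` hits at most `m` vertices with multiplicity, so some `z` is hit
    -- fewer times than its 0/1 admissibility indicator. That `z` is admissible and not hit at all.
    fresh-extension : ∀ S v σ x′ (φ : Fin m → Fin n) → m < codegree S v σ x′ →
      ∃ λ z → Extends S v σ x′ z × (∀ u → φ u ≢ z)
    fresh-extension S v σ x′ φ many
      with ∑-<⇒∃ V (λ z → ∑ (allFin m) (λ u → ⟦ φ u ≟ z ⟧)) (λ z → ⟦ extends? S v σ x′ z ⟧)
             (≤-<-trans occupied many)
      where
      occupied : ∑ V (λ z → ∑ (allFin m) (λ u → ⟦ φ u ≟ z ⟧)) ≤ m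
      occupied = begin
        ∑ V (λ z → ∑ (allFin m) (λ u → ⟦ φ u ≟ z ⟧))  ≡⟨ ∑-swap V (allFin m) _ ⟩
        ∑ (allFin m) (λ u → ∑ V (λ z → ⟦ φ u ≟ z ⟧))  ≤⟨ ∑-≤ (allFin m) (λ u → ∑-unique _≟_ (allFin⁺ n) (φ u)) ⟩
        length (allFin m) * 1                          ≡⟨ *-identityʳ _ ⟩
        length (allFin m)                              ≡⟨ length-allFin m ⟩
        m                                              ∎
        where open ≤-Reasoning
    ... | z , lt = z , ⟦⟧>0⇒ (extends? S v σ x′ z) (≤-<-trans z≤n lt) , unused
      where
      unused : ∀ u → φ u ≢ z
      unused u φu≡z = <-irrefl refl (begin-strict
        1                                    ≤⟨ ⇒⟦⟧>0 (φ u ≟ z) φu≡z ⟩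
        ⟦ φ u ≟ z ⟧                          ≤⟨ ∈⇒≤∑ (λ u → ⟦ φ u ≟ z ⟧) (∈-allFin u) ⟩
        ∑ (allFin m) (λ u → ⟦ φ u ≟ z ⟧)     <⟨ lt ⟩
        ⟦ extends? S v σ x′ z ⟧              ≤⟨ ⟦⟧≤1 (extends? S v σ x′ z) ⟩
        1                                    ∎)
        where open ≤-Reasoning

    add-vertex : ∀ S v → v ∈ S → length (nbrs S v) ≤ d → Partial (S - v) → Partial S
    add-vertex S v v∈S few partial = record { φ = φ′ ; inj = inj′ ; fits = fits′ }
      where
      open Partial partial
      p : Fin (suc k)
      p = part v
      x′ : Vec (Vec (Fin n) s) k
      x′ = removeAt x p
      σ : Vec (Fin n) d
      σ = proj₁ (assign-surjective φ (nbrs S v) few)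
      σ-agrees : ∀ {u} → u ∈ₗ nbrs S v → assign (nbrs S v) σ u ≡ φ u
      σ-agrees = proj₂ (assign-surjective φ (nbrs S v) few)

      -- The invariant for `S - v`, with index `b` written at `p`, makes an edge through `v` read
      -- sample vertex `b` of row `p`. Hence that whole row consists of admissible images of `v`.
      sample-slot : ∀ b c → E c → lookup c p ≡ v → ∀ a i →
        mix (S - v) φ c (a [ p ]≔ b) i ≡ slot S v σ x′ (lookup (lookup x p) b) c a i
      sample-slot b c c∈E cp≡v a i with part v ≟ i
      ... | yes refl = trans
        (if-no (lookup c p ∈? (S - v)) (subst (_∉ (S - v)) (sym cp≡v) (x∉p-x S v)))
        (cong (lookup (lookup x p)) (lookup∘updateAt p a))
      ... | no p≢i with lookup c i ∈? S
      ...   | yes ci∈S = trans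
        (if-yes (lookup c i ∈? (S - v)) (x∈p∧x≢y⇒x∈p-y ci∈S ci≢v))
        (sym (σ-agrees (nbrs-complete c∈E S v i cp≡v p≢i ci∈S)))
        where
        ci≢v : lookup c i ≢ v
        ci≢v ci≡v = p≢i (trans (cong part (sym ci≡v)) (E-part c∈E i))
      ...   | no ci∉S = trans
        (if-no (lookup c i ∈? (S - v)) (ci∉S ∘ p─q⊆p S ⁅ v ⁆))
        (cong₂ lookup (sym (removeAt-punchOut x p≢i)) (lookup∘updateAt′ i p (p≢i ∘ sym) a))

      found : ∃ λ z → Extends S v σ x′ z × (∀ u → φ u ≢ z)
      found = fresh-extension S v σ x′ φ (many-extensions S v σ
        (λ b c c∈E cp≡v a → subst R (tabulate-cong (sample-slot b c c∈E cp≡v a)) (fits c c∈E (a [ p ]≔ b))))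
      z : Fin n
      z = proj₁ found

      φ′ : Fin m → Fin n
      φ′ u = if does (u ≟ v) then z else φ u

      inj′ : ∀ {u u′} → u ∈ S → u′ ∈ S → φ′ u ≡ φ′ u′ → u ≡ u′
      inj′ {u} {u′} u∈S u′∈S eq with u ≟ v | u′ ≟ v
      ... | yes u≡v | yes u′≡v = trans u≡v (sym u′≡v)
      ... | yes _   | no _     = ⊥-elim (proj₂ (proj₂ found) u′ (sym eq))
      ... | no _    | yes _    = ⊥-elim (proj₂ (proj₂ found) u eq)
      ... | no u≢v  | no u′≢v  = inj (x∈p∧x≢y⇒x∈p-y u∈S u≢v) (x∈p∧x≢y⇒x∈p-y u′∈S u′≢v) eq

      slot-mix : ∀ c → E c → lookup c p ≡ v → ∀ a i → slot S v σ x′ z c a i ≡ mix S φ′ c a i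
      slot-mix c c∈E cp≡v a i with part v ≟ i
      ... | yes refl = sym (trans
        (if-yes (lookup c p ∈? S) (subst (_∈ S) (sym cp≡v) v∈S))
        (if-yes (lookup c p ≟ v) cp≡v))
      ... | no p≢i with lookup c i ∈? S
      ...   | yes ci∈S = trans (σ-agrees (nbrs-complete c∈E S v i cp≡v p≢i ci∈S))
        (sym (if-no (lookup c i ≟ v) (λ ci≡v → p≢i (trans (cong part (sym ci≡v)) (E-part c∈E i)))))
      ...   | no _ = cong (λ ys → lookup ys (lookup a i)) (removeAt-punchOut x p≢i)

      mix-mix : ∀ c → E c → lookup c p ≢ v → ∀ a i → mix (S - v) φ c a i ≡ mix S φ′ c a i
      mix-mix c c∈E cp≢v a i with lookup c i ∈? S
      ... | yes ci∈S = trans (if-yes (lookup c i ∈? (S - v)) (x∈p∧x≢y⇒x∈p-y ci∈S ci≢v))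
                             (sym (if-no (lookup c i ≟ v) ci≢v))
        where
        ci≢v : lookup c i ≢ v
        ci≢v ci≡v = cp≢v (subst (λ j → lookup c j ≡ v) (trans (sym (E-part c∈E i)) (cong part ci≡v)) ci≡v)
      ... | no ci∉S = if-no (lookup c i ∈? (S - v)) (ci∉S ∘ p─q⊆p S ⁅ v ⁆)

      fits′ : ∀ c → E c → ∀ a → R (tabulate (mix S φ′ c a))
      -- Edges through `v` are handled by the choice of `z`. Other edges avoid `v` altogether, as
      -- `v` can only occupy coordinate `part v`, and keep the old invariant.
      fits′ c c∈E a with lookup c p ≟ v
      ... | yes cp≡v = subst R (tabulate-cong (slot-mix c c∈E cp≡v a)) (proj₁ (proj₂ found) c c∈E cp≡v a)
      ... | no  cp≢v = subst R (tabulate-cong (mix-mix c c∈E cp≢v a)) (fits c c∈E a)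

    -- A vertex with at most `d` neighbours in `S` is removed and embedded after the rest, which
    -- follows a degeneracy order. The bound `r` drives the recursion.
    partial-embedding : ∀ r S → ∣ S ∣ ≤ r → Partial S
    partial-embedding r S ∣S∣≤r with nonempty? S
    partial-embedding r       S ∣S∣≤r | no empty = empty-partial S empty
    partial-embedding zero    S ∣S∣≤0 | yes (u , u∈S) =
      ⊥-elim (n≮0 (<-≤-trans (x∈p⇒∣p-x∣<∣p∣ u∈S) ∣S∣≤0))
    partial-embedding (suc r) S ∣S∣≤r | yes nonempty with degenerate S nonempty
    ... | v , v∈S , few = add-vertex S v v∈S few
      (partial-embedding r (S - v) (≤-pred (≤-trans (x∈p⇒∣p-x∣<∣p∣ v∈S) ∣S∣≤r)))

    -- At `S = ⊤` the tuple `mix` no longer reads the sample. The argument `a` is there to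
    -- instantiate the invariant, which would be vacuous for `s = 0`.
    embedding : Vec (Fin s) (suc k) → ∃ λ (φ : Fin m → Fin n) →
      (∀ {u u′} → φ u ≡ φ u′ → u ≡ u′) × (∀ c → E c → R (Vec.map φ c))
    embedding a = φ , inj ∈⊤ ∈⊤ , λ c c∈E → subst R (mix-⊤ c) (fits c c∈E a)
      where
      open Partial (partial-embedding ∣ ⊤ {m} ∣ ⊤ ≤-refl)
      mix-⊤ : ∀ c → tabulate (mix ⊤ φ c a) ≡ Vec.map φ c
      mix-⊤ c = begin
        tabulate (mix ⊤ φ c a)            ≡⟨ tabulate-cong {g = φ ∘ lookup c} (λ i → if-yes (lookup c i ∈? ⊤) {b = lookup (lookup x i) (lookup a i)} ∈⊤) ⟩
        tabulate (λ i → φ (lookup c i))   ≡⟨ tabulate-∘ φ (lookup c) ⟩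
        Vec.map φ (tabulate (lookup c))   ≡⟨ cong (Vec.map φ) (tabulate∘lookup c) ⟩
        Vec.map φ c                       ∎
        where open ≡-Reasoning

-- Edges as images of ordered tuples.

image : ∀ {n k} → Vec (Fin n) k → Subset n
image []      = ∅
image (y ∷ c) = ⁅ y ⁆ ∪ image c

lookup∈image : ∀ {n k} (c : Vec (Fin n) k) i → lookup c i ∈ image c
lookup∈image (y ∷ c) zero    = p⊆p∪q (image c) (x∈⁅x⁆ y)
lookup∈image (y ∷ c) (suc i) = q⊆p∪q ⁅ y ⁆ (image c) (lookup∈image c i)

image⊆ : ∀ {n k} (c : Vec (Fin n) k) {e : Subset n} → (∀ i → lookup c i ∈ e) → image c ⊆ e
image⊆ []      h u∈ = ⊥-elim (∉⊥ u∈)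
image⊆ (y ∷ c) {e} h u∈ with x∈p∪q⁻ ⁅ y ⁆ (image c) u∈
... | inj₁ u∈y = subst (_∈ e) (sym (x∈⁅y⁆⇒x≡y y u∈y)) (h zero)
... | inj₂ u∈c = image⊆ c (h ∘ suc) u∈c

image-map-suc : ∀ {n k} (c : Vec (Fin n) k) → image (Vec.map suc c) ≡ false ∷ image c
image-map-suc []      = refl
image-map-suc (y ∷ c) = cong (⁅ suc y ⁆ ∪_) (image-map-suc c)

image-surjective : ∀ {n} (f : Subset n) → ∃ λ (c : Vec (Fin n) ∣ f ∣) → image c ≡ f
image-surjective []          = [] , refl
image-surjective (false ∷ f) with image-surjective f
... | c , eq = Vec.map suc c , trans (image-map-suc c) (cong (false ∷_) eq)
image-surjective (true ∷ f) with image-surjective f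
... | c , eq = zero ∷ Vec.map suc c ,
  trans (cong (⁅ zero ⁆ ∪_) (image-map-suc c)) (cong (true ∷_) (trans (∪-identityˡ _) eq))

_≟ˢ_ : ∀ {n} (e f : Subset n) → Dec (e ≡ f)
_≟ˢ_ = ≡-dec Bool._≟_

allSubsets-unique : ∀ n → Unique (allSubsets n)
allSubsets-unique zero    = [] ∷ []
allSubsets-unique (suc n) =
  ++⁺ (map⁺ ∷-injectiveʳ (allSubsets-unique n)) (map⁺ ∷-injectiveʳ (allSubsets-unique n)) disjoint
  where
  disjoint : ∀ {S} → ¬ (S ∈ₗ map (true ∷_) (allSubsets n) × S ∈ₗ map (false ∷_) (allSubsets n))
  disjoint (∈true , ∈false) with ∈-map⁻ (true ∷_) ∈true | ∈-map⁻ (false ∷_) ∈false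
  ... | _ , _ , refl | _ , _ , ()

length-filterᵇ : {A : Set} (p : A → Bool) (xs : List A) → length (filterᵇ p xs) ≡ ∑ xs (λ x → ⟦ T? (p x) ⟧)
length-filterᵇ p []       = refl
length-filterᵇ p (x ∷ xs) with p x
... | true  = cong suc (length-filterᵇ p xs)
... | false = length-filterᵇ p xs

-- Every edge is the image of some ordering of its vertices, and a tuple has only one image. Tuples
-- with repeated entries have images too small to be edges.
numEdges≤∑ : ∀ {k} (G : Hypergraph k) →
  numEdges G ≤ ∑ (vecs (allFin (nV G)) k) (λ y → ⟦ T? (edge G (image y)) ⟧)
numEdges≤∑ {k} G = begin
  numEdges G
    ≡⟨ length-filterᵇ (edge G) (allSubsets n) ⟩
  ∑ (allSubsets n) (λ f → ⟦ T? (edge G f) ⟧)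
    ≤⟨ ∑-mono (allSubsets n) (λ f → enumerate f (T? (edge G f))) ⟩
  ∑ (allSubsets n) (λ f → ∑ tuples (λ y → ⟦ isEdge y ⟧ * ⟦ image y ≟ˢ f ⟧))
    ≡⟨ ∑-swap (allSubsets n) tuples _ ⟩
  ∑ tuples (λ y → ∑ (allSubsets n) (λ f → ⟦ isEdge y ⟧ * ⟦ image y ≟ˢ f ⟧))
    ≤⟨ ∑-mono tuples (λ y → begin
      ∑ (allSubsets n) (λ f → ⟦ isEdge y ⟧ * ⟦ image y ≟ˢ f ⟧)
        ≡⟨ ∑-*ˡ (allSubsets n) ⟦ isEdge y ⟧ _ ⟩
      ⟦ isEdge y ⟧ * ∑ (allSubsets n) (λ f → ⟦ image y ≟ˢ f ⟧)
        ≤⟨ *-monoʳ-≤ ⟦ isEdge y ⟧ (∑-unique _≟ˢ_ (allSubsets-unique n) (image y)) ⟩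
      ⟦ isEdge y ⟧ * 1
        ≡⟨ *-identityʳ _ ⟩
      ⟦ isEdge y ⟧ ∎) ⟩
  ∑ tuples (λ y → ⟦ isEdge y ⟧) ∎
  where
  open ≤-Reasoning
  n : ℕ
  n = nV G
  tuples : List (Vec (Fin n) k)
  tuples = vecs (allFin n) k
  isEdge : ∀ y → Dec (T (edge G (image {k = k} y)))
  isEdge y = T? (edge G (image y))
  tuple : ∀ f → T (edge G f) → ∃ λ (y : Vec (Fin n) k) → image y ≡ f
  tuple f f∈G = subst (λ j → ∃ λ (y : Vec (Fin n) j) → image y ≡ f) (uniform G f f∈G) (image-surjective f)
  enumerate : ∀ f (f∈G? : Dec (T (edge G f))) → ⟦ f∈G? ⟧ ≤ ∑ tuples (λ y → ⟦ isEdge y ⟧ * ⟦ image y ≟ˢ f ⟧)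
  enumerate f (no _)    = z≤n
  enumerate f (yes f∈G) with tuple f f∈G
  ... | y , refl = ≤-trans
    (*-mono-≤ (⇒⟦⟧>0 (isEdge y) f∈G) (⇒⟦⟧>0 (image y ≟ˢ image y) refl))
    (∈⇒≤∑ (λ y′ → ⟦ isEdge y′ ⟧ * ⟦ image y′ ≟ˢ f ⟧) (∈-vecs ∈-allFin y))

-- Exponent arithmetic: from edge density to many samples.

-- This dictates the exponent in the theorem: the power `s ^ suc k` in `blowup-count` is `b * d`, so
-- the density hypothesis enters raised to the power `d`.
sample-exponent : ∀ k d → (2 * d) ^ suc k ≡ (2 ^ suc k * d ^ k) * d
sample-exponent k d = trans (^-distribʳ-* (suc k) 2 d) (reassoc (2 ^ suc k) d (d ^ k))
  where
  reassoc : ∀ a b c → a * (b * c) ≡ a * c * b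
  reassoc = solve-∀

-- The density loss `n ^ (1 / b)` per edge factor accumulates to `n ^ d`. What remains of
-- `n ^ (suc k * s)` is `n ^ d * (n ^ s) ^ k`, the same order as the bound on bad events.
many-samples : ∀ (n k d C e N : ℕ) .{{_ : NonZero n}} → let s = 2 * d; b = 2 ^ suc k * d ^ k in
  C ^ b * n ^ (suc k * b) ≤ e ^ b * n ^ 1 →
  e ^ (s ^ suc k) * n ^ (suc k * s) ≤ N * n ^ (suc k * s ^ suc k) →
  C ^ (s ^ suc k) * (n ^ d * (n ^ s) ^ k) ≤ N
many-samples n k d C e N dense count =
  *-cancelʳ-≤ _ _ (n ^ d) {{m^n≢0 n d}} (*-cancelʳ-≤ _ _ W {{m^n≢0 n (K * s ^ K)}} (begin
    C ^ (s ^ K) * (n ^ d * (n ^ s) ^ k) * n ^ d * W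
      ≡⟨ shuffle₁ (C ^ (s ^ K)) (n ^ d) ((n ^ s) ^ k) W ⟩
    (C ^ (s ^ K) * W) * (n ^ d * n ^ d * (n ^ s) ^ k)
      ≡⟨ cong₂ _*_ powers samples ⟩
    (C ^ b * n ^ (K * b)) ^ d * n ^ (K * s)
      ≤⟨ *-monoˡ-≤ (n ^ (K * s)) (^-monoˡ-≤ d dense) ⟩
    (e ^ b * n ^ 1) ^ d * n ^ (K * s)
      ≡⟨ cong (_* n ^ (K * s)) (trans (^-distribʳ-* d (e ^ b) (n ^ 1)) (cong₂ _*_ (^-*-assoc e b d)
           (trans (^-*-assoc n 1 d) (cong (n ^_) (*-identityˡ d))))) ⟩
    e ^ (b * d) * n ^ d * n ^ (K * s)
      ≡⟨ cong (λ t → e ^ t * n ^ d * n ^ (K * s)) (sample-exponent k d) ⟨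
    e ^ (s ^ K) * n ^ d * n ^ (K * s)
      ≡⟨ shuffle₂ (e ^ (s ^ K)) (n ^ d) (n ^ (K * s)) ⟩
    e ^ (s ^ K) * n ^ (K * s) * n ^ d
      ≤⟨ *-monoˡ-≤ (n ^ d) count ⟩
    N * W * n ^ d
      ≡⟨ shuffle₂ N W (n ^ d) ⟩
    N * n ^ d * W ∎))
  where
  open ≤-Reasoning
  K s b W : ℕ
  K = suc k
  s = 2 * d
  b = 2 ^ K * d ^ k
  W = n ^ (K * s ^ K)
  shuffle₁ : ∀ a b c w → a * (b * c) * b * w ≡ (a * w) * (b * b * c)
  shuffle₁ = solve-∀
  shuffle₂ : ∀ a b c → a * b * c ≡ a * c * b
  shuffle₂ = solve-∀
  powers : C ^ (s ^ K) * W ≡ (C ^ b * n ^ (K * b)) ^ d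
  powers = begin-equality
    C ^ (s ^ K) * n ^ (K * s ^ K)     ≡⟨ cong (λ t → C ^ t * n ^ (K * t)) (sample-exponent k d) ⟩
    C ^ (b * d) * n ^ (K * (b * d))   ≡⟨ cong (λ t → C ^ (b * d) * n ^ t) (*-assoc K b d) ⟨
    C ^ (b * d) * n ^ (K * b * d)     ≡⟨ cong₂ _*_ (^-*-assoc C b d) (^-*-assoc n (K * b) d) ⟨
    (C ^ b) ^ d * (n ^ (K * b)) ^ d   ≡⟨ ^-distribʳ-* d (C ^ b) (n ^ (K * b)) ⟨
    (C ^ b * n ^ (K * b)) ^ d         ∎
  -- The choice `s = 2 * d` enters here: one `n ^ d` is the density loss, the other the choices of
  -- `σ`.
  samples : n ^ d * n ^ d * (n ^ s) ^ k ≡ n ^ (K * s)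
  samples = begin-equality
    n ^ d * n ^ d * (n ^ s) ^ k   ≡⟨ cong (_* (n ^ s) ^ k) (^-distribˡ-+-* n d d) ⟨
    n ^ (d + d) * (n ^ s) ^ k     ≡⟨ cong (λ t → n ^ (d + t) * (n ^ s) ^ k) (+-identityʳ d) ⟨
    n ^ s * (n ^ s) ^ k           ≡⟨ ^-*-assoc n s K ⟩
    n ^ (s * K)                   ≡⟨ cong (n ^_) (*-comm s K) ⟩
    n ^ (K * s)                   ∎

-- Finding the copy of `H` in a dense host.

module _ {k : ℕ} (H : Hypergraph (suc k)) (d : ℕ) (partite : KPartite H)
  (degen : SkelDegenerate H d) (d>0 : 1 ≤ d) where

  private
    m s L C : ℕ
    m = nV H
    s = 2 * d
    L = length (allSubsets m)
    -- One more than the constant in `badTotal-count`, to make the comparison strict.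
    C = suc (L * (m * m ^ s))

    part : Fin m → Fin (suc k)
    part = proj₁ partite

    -- Edges of `H` are listed in part order, so coordinate `i` of a tuple and row `i` of a sample
    -- belong to the same part.
    E : Vec (Fin m) (suc k) → Set
    E c = T (edge H (image c)) × (∀ i → part (lookup c i) ≡ i)

    E? : ∀ c → Dec (E c)
    E? c = T? (edge H (image c)) ×-dec all? (λ i → part (lookup c i) ≟ i)

    -- Its length is `degIn H S v` by definition, so `degen` fits the greedy embedding as it stands.
    nbrs : Subset m → Fin m → List (Fin m)
    nbrs S v = filterᵇ (λ w → lookup S w ∧ skelAdj H v w) (allFin m)

    E-covers : ∀ e → T (edge H e) → ∃ λ c → E c × (∀ {u} → u ∈ e → lookup c (part u) ≡ u)
    E-covers e e∈H = c , (subst (T ∘ edge H) (sym image≡e) e∈H , c-part) , covers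
      where
      transversal : ∀ i → ∃ λ u → u ∈ e × part u ≡ i
      transversal = proj₁ (proj₂ partite e e∈H)
      c : Vec (Fin m) (suc k)
      c = tabulate (λ i → proj₁ (transversal i))
      c≡ : ∀ i → lookup c i ≡ proj₁ (transversal i)
      c≡ = lookup∘tabulate (λ i → proj₁ (transversal i))
      c∈e : ∀ i → lookup c i ∈ e
      c∈e i = subst (_∈ e) (sym (c≡ i)) (proj₁ (proj₂ (transversal i)))
      c-part : ∀ i → part (lookup c i) ≡ i
      c-part i = trans (cong part (c≡ i)) (proj₂ (proj₂ (transversal i)))
      covers : ∀ {u} → u ∈ e → lookup c (part u) ≡ u
      covers {u} u∈e = proj₂ (proj₂ partite e e∈H) _ u (c∈e (part u)) u∈e (c-part (part u))
      image≡e : image c ≡ e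
      image≡e = ⊆-antisym (image⊆ c c∈e)
        (λ {u} u∈e → subst (_∈ image c) (covers u∈e) (lookup∈image c (part u)))

    T-lookup : ∀ {S : Subset m} {u} → u ∈ S → T (lookup S u)
    T-lookup = Equivalence.from Bool.T-≡ ∘ []=⇒lookup

    T-∧⁺ : ∀ {x y} → T x → T y → T (x ∧ y)
    T-∧⁺ tx ty = Equivalence.from Bool.T-∧ (tx , ty)

    T-not : {P : Set} (P? : Dec P) → ¬ P → T (not ⌊ P? ⌋)
    T-not (yes p) ¬p = ¬p p
    T-not (no _)  _  = _

    -- The edge `image c` itself witnesses adjacency, and distinct parts make the two vertices
    -- distinct.
    nbrs-complete : ∀ {c} → E c → ∀ S v i → lookup c (part v) ≡ v → part v ≢ i →
      lookup c i ∈ S → lookup c i ∈ₗ nbrs S v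
    nbrs-complete {c} (c∈H , c-part) S v i cv≡v pv≢i ci∈S =
      ∈-filter⁺ (λ w → T? (lookup S w ∧ skelAdj H v w)) (∈-allFin (lookup c i))
        (T-∧⁺ (T-lookup ci∈S) (T-∧⁺
          (T-not (v ≟ lookup c i) (λ v≡ci → pv≢i (trans (cong part v≡ci) (c-part i))))
          (any⁺ _ (lose (∈-allSubsets (image c)) (T-∧⁺ c∈H (T-∧⁺
            (T-lookup (subst (_∈ image c) cv≡v (lookup∈image c (part v))))
            (T-lookup (lookup∈image c i))))))))

  -- First-moment argument: some sample has `badTotal` below its blow-up weight. That weight is at
  -- most 1, so it is positive and `badTotal` is zero.
  copy : (G : Hypergraph (suc k)) → 1 ≤ nV G → let b = 2 ^ suc k * d ^ k in
    C ^ b * nV G ^ (suc k * b) ≤ numEdges G ^ b * nV G ^ 1 → ContainsCopy G H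
  copy G n>0 dense
    with ∑-<⇒∃ (vecs (vecs (allFin (nV G)) s) (suc k)) badTotal (blowup (suc k) w) bad<good
    where
    n : ℕ
    n = nV G
    open GreedyEmbedding {n = n} {s = s} {d = d} part E? (λ y → T? (edge G (image y))) nbrs (fromℕ< n>0)
      using (badTotal; badTotal-count)
    w : Vec (Fin n) (suc k) → ℕ
    w y = ⟦ T? (edge G (image y)) ⟧
    instance
      n≢0 : NonZero n
      n≢0 = >-nonZero n>0
      M≢0 : NonZero (n ^ d * (n ^ s) ^ k)
      M≢0 = m*n≢0 (n ^ d) ((n ^ s) ^ k) {{m^n≢0 n d}} {{m^n≢0 (n ^ s) k {{m^n≢0 n s}}}}
    count : numEdges G ^ (s ^ suc k) * n ^ (suc k * s)
      ≤ ∑ (vecs (vecs (allFin n) s) (suc k)) (blowup (suc k) w) * n ^ (suc k * s ^ suc k)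
    count = ≤-trans
      (*-monoˡ-≤ (n ^ (suc k * s)) (^-monoˡ-≤ (s ^ suc k) (numEdges≤∑ G)))
      (subst (λ l → ∑ (vecs (allFin n) (suc k)) w ^ (s ^ suc k) * l ^ (suc k * s)
                ≤ ∑ (vecs (vecs (allFin n) s) (suc k)) (blowup (suc k) w) * l ^ (suc k * s ^ suc k))
        (length-allFin n)
        (blowup-count (allFin n) s (suc k) w {{subst NonZero (sym (length-allFin n)) n≢0}}))
    exponent>0 : 1 ≤ s ^ suc k
    exponent>0 = m^n>0 s {{>-nonZero (≤-trans d>0 (m≤m+n d _))}} (suc k)
    bad<good : ∑ (vecs (vecs (allFin n) s) (suc k)) badTotal
      < ∑ (vecs (vecs (allFin n) s) (suc k)) (blowup (suc k) w)
    bad<good = begin-strict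
      ∑ (vecs (vecs (allFin n) s) (suc k)) badTotal    ≤⟨ badTotal-count ⟩
      L * (m * (n ^ d * ((n ^ s) ^ k * m ^ s)))        ≡⟨ regroup L m (n ^ d) ((n ^ s) ^ k) (m ^ s) ⟩
      L * (m * m ^ s) * (n ^ d * (n ^ s) ^ k)          <⟨ *-monoˡ-< (n ^ d * (n ^ s) ^ k) (n<1+n (L * (m * m ^ s))) ⟩
      C * (n ^ d * (n ^ s) ^ k)                        ≡⟨ cong (_* (n ^ d * (n ^ s) ^ k)) (^-identityʳ C) ⟨
      C ^ 1 * (n ^ d * (n ^ s) ^ k)                    ≤⟨ *-monoˡ-≤ (n ^ d * (n ^ s) ^ k) (^-monoʳ-≤ C exponent>0) ⟩
      C ^ (s ^ suc k) * (n ^ d * (n ^ s) ^ k)          ≤⟨ many-samples n k d C (numEdges G) _ dense count ⟩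
      ∑ (vecs (vecs (allFin n) s) (suc k)) (blowup (suc k) w) ∎
      where
      open ≤-Reasoning
      regroup : ∀ a b c e f → a * (b * (c * (e * f))) ≡ a * (b * f) * (c * e)
      regroup = solve-∀
  ... | x , bad<1 = φ , inj , λ e e∈H → edge-image e (E-covers e e∈H)
    where
    isEdge : ∀ y → Dec (T (edge G (image {k = suc k} y)))
    isEdge y = T? (edge G (image y))
    open GreedyEmbedding {n = nV G} {s = s} {d = d} part E? isEdge nbrs (fromℕ< n>0)
    sampled : ∃ λ (φ : Fin m → Fin (nV G)) →
      (∀ {u u′} → φ u ≡ φ u′ → u ≡ u′) × (∀ c → E c → T (edge G (image (Vec.map φ c))))
    sampled = embedding proj₂ (λ {c} → nbrs-complete {c}) degen x
      (λ a → ⟦⟧>0⇒ (isEdge (select x a)) (blowup>0⇒ (suc k) _ x (≤-<-trans z≤n bad<1) a))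
      (n<1⇒n≡0 (<-≤-trans bad<1 (blowup≤1 (suc k) _ (⟦⟧≤1 ∘ isEdge) x)))
      (Vec.replicate (suc k) (fromℕ< (≤-trans d>0 (m≤m+n d _))))
    φ : Fin m → Fin (nV G)
    φ = proj₁ sampled
    inj : ∀ {u u′} → φ u ≡ φ u′ → u ≡ u′
    inj = proj₁ (proj₂ sampled)
    edge-image : ∀ e → (∃ λ c → E c × (∀ {u} → u ∈ e → lookup c (part u) ≡ u)) →
      ∃ λ f → T (edge G f) × (∀ u → u ∈ e → φ u ∈ f)
    edge-image e (c , c∈E , covers) = image (Vec.map φ c) , proj₂ (proj₂ sampled) c c∈E ,
      λ u u∈e → subst (_∈ image (Vec.map φ c))
        (trans (lookup-map (part u) φ c) (cong φ (covers u∈e)))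
        (lookup∈image (Vec.map φ c) (part u))

-- The constant `c_k` is `a / b`, and the edge bound is raised to the power `b * d ^ (k - 1)` to
-- stay within natural numbers.
theorem2p5 : (k : ℕ) → 2 ≤ k →
    ∃₂ λ (a b : ℕ) → 0 < a × 0 < b ×
    ((H : Hypergraph k) → (d : ℕ) → KPartite H → IsSkelDegeneracy H d → 1 ≤ d →
    ∃ λ (C : ℕ) → (G : Hypergraph k) → 1 ≤ nV G →
    C ^ (b * d ^ (k ∸ 1)) * nV G ^ (k * (b * d ^ (k ∸ 1)))
    ≤ numEdges G ^ (b * d ^ (k ∸ 1)) * nV G ^ a →
    ContainsCopy G H)
theorem2p5 (suc k) _ =
  -- `c_k` is 2 to the minus uniformity, the factor 2 coming from `s = 2 * d`.
  1 , 2 ^ suc k , z<s , m^n>0 2 (suc k) ,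
  λ H d partite degeneracy d>0 → _ , copy H d partite (proj₁ degeneracy) d>0
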